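{- Every underclosed simplicial complex is weakly-closed and skeleton-weakly-chordal. The converse is false: there is a simplicial complex that is weakly-closed and skeleton-weakly-chordal but not underclosed.
   Context: Simplicial complexes are finite and not necessarily pure. A vertex labeling of a complex with $n$ vertices is a bijection of its vertices with $[n]=\{1,\dots,n\}$; $\min F,\max F$ denote the smallest and largest labels in $F$; the size of a face is its number of vertices. Two faces of the same dimension $k$ are adjacent if their intersection has dimension $k-1$. For sets $G=\{g_0<\dots<g_k\}$, $F=\{f_0<\dots<f_k\}$ of the same size, $G\le F$ componentwise means $g_i\le f_i$ for all $i$. A complex $\Delta$ with $n$ vertices is: - underclosed, if it has a labeling such that for every facet $F$ of $\Delta$ and every $G\subseteq[n]$ with $|G|=|F|$, if $\min G=\min F$ and $G\le F$ componentwise, then $G\in\Delta$; - weakly-closed, if it has a labeling such that for every facet $F$ of $\Delta$ and every integer $g\notin F$ with $\min F<g<\max F$, $\Delta$ contains some face $G$ of the same size as $F$, adjacent to $F$, and containing $g$; - skeleton-weakly-chordal, if it has a labeling such that for every two faces $f\neq g$ of $\Delta$ with the same size and same maximum, $\Delta$ contains some face $h$ with $|h|=|f|$ and $h\subseteq (f\cup g)\setminus\{\max f\}$. The labelings witnessing different properties may be different. -}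

module Defs where

open import Data.Fin.Base using (Fin; _≤_; _<_)
open import Data.Fin.Permutation using (Permutation′; _⟨$⟩ʳ_; _⟨$⟩ˡ_; inverseˡ)
open import Data.Fin.Subset using (Subset; _∈_; _∉_; _⊆_; _∩_; _∪_; _-_; ⁅_⁆; ∣_∣)
open import Data.Fin.Subset.Properties using (_∈?_; x∈⁅x⁆; x∈⁅y⁆⇒x≡y)
open import Data.List.Base using (List; filter; allFin)
open import Data.List.Relation.Binary.Pointwise using (Pointwise)
open import Data.Nat.Base using (ℕ; suc)
open import Data.Product.Base using (_×_; ∃-syntax)
open import Data.Vec.Base using (lookup; tabulate)
open import Data.Vec.Properties using (lookup∘tabulate; lookup⇒[]=; []=⇒lookup)
open import Relation.Binary.PropositionalEquality using (_≡_; _≢_; sym; trans; cong; subst)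
open import Relation.Unary using (Pred; Decidable)
open import Level using (0ℓ)

private
  variable
    n : ℕ

-- A finite simplicial complex with vertex set Fin n; every element of Fin n
-- is a vertex.  Face membership is decidable, as for any classically given
-- finite complex.  For n > 0 the empty face belongs to the complex by downward
-- closure; for n = 0 both the void complex and { ∅ } are allowed.
record SimplicialComplex (n : ℕ) : Set₁ where
  field
    Face        : Pred (Subset n) 0ℓ
    face?       : Decidable Face
    down-closed : ∀ {F G} → G ⊆ F → Face F → Face G
    vertex      : ∀ v → Face ⁅ v ⁆

open SimplicialComplex public using (Face)

Facet : SimplicialComplex n → Pred (Subset n) 0ℓ
Facet Δ F = Face Δ F × (∀ G → Face Δ G → F ⊆ G → F ≡ G)

IsMin : Subset n → Fin n → Set
IsMin F m = m ∈ F × (∀ {x} → x ∈ F → m ≤ x)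

IsMax : Subset n → Fin n → Set
IsMax F m = m ∈ F × (∀ {x} → x ∈ F → x ≤ m)

-- allFin is increasing, so this lists the elements of F in increasing order.
elements : Subset n → List (Fin n)
elements {n} F = filter (_∈? F) (allFin n)

infix 4 _≤ᶜ_

_≤ᶜ_ : Subset n → Subset n → Set
G ≤ᶜ F = Pointwise _≤_ (elements G) (elements F)

-- A face of size s has dimension s - 1, so "the intersection has dimension
-- k - 1" says that its size is one less than the common size k + 1.
Adjacent : Subset n → Subset n → Set
Adjacent F G = ∣ F ∣ ≡ ∣ G ∣ × suc ∣ F ∩ G ∣ ≡ ∣ F ∣

-- A labeling is a permutation π of Fin n sending each vertex to its label
-- (labels run from 0 to n - 1 instead of from 1 to n).

-- The set of vertices whose labels lie in S.
preimage : Permutation′ n → Subset n → Subset n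
preimage π S = tabulate (λ v → lookup S (π ⟨$⟩ʳ v))

∈-preimage⁺ : ∀ (π : Permutation′ n) {S v} → π ⟨$⟩ʳ v ∈ S → v ∈ preimage π S
∈-preimage⁺ π {S} {v} p =
  lookup⇒[]= v _ (trans (lookup∘tabulate _ v) ([]=⇒lookup p))

∈-preimage⁻ : ∀ (π : Permutation′ n) {S v} → v ∈ preimage π S → π ⟨$⟩ʳ v ∈ S
∈-preimage⁻ π {S} {v} p =
  lookup⇒[]= (π ⟨$⟩ʳ v) S (trans (sym (lookup∘tabulate _ v)) ([]=⇒lookup p))

-- The complex Δ with each vertex replaced by its label.
relabel : Permutation′ n → SimplicialComplex n → SimplicialComplex n
relabel π Δ = record
  { Face        = λ S → Face Δ (preimage π S)
  ; face?       = λ S → face? (preimage π S)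
  ; down-closed = λ G⊆F → down-closed
                    (λ x∈G → ∈-preimage⁺ π (G⊆F (∈-preimage⁻ π x∈G)))
  ; vertex      = λ l → down-closed (preimage-⁅⁆ l) (vertex (π ⟨$⟩ˡ l))
  }
  where
  open SimplicialComplex Δ using (face?; down-closed; vertex)
  preimage-⁅⁆ : ∀ l → preimage π ⁅ l ⁆ ⊆ ⁅ π ⟨$⟩ˡ l ⁆
  preimage-⁅⁆ l {v} v∈ =
    subst (_∈ ⁅ π ⟨$⟩ˡ l ⁆)
      (trans (cong (π ⟨$⟩ˡ_) (sym (x∈⁅y⁆⇒x≡y l (∈-preimage⁻ π v∈)))) (inverseˡ π))
      (x∈⁅x⁆ (π ⟨$⟩ˡ l))

-- The conditions on a complex whose vertices are identified with their labels.
-- The hypotheses IsMin F a, IsMin G a express min F = min G (= a), and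
-- similarly for maxima.

UnderclosedLabeled : SimplicialComplex n → Set
UnderclosedLabeled Δ =
  ∀ F → Facet Δ F → ∀ G → ∣ G ∣ ≡ ∣ F ∣ →
  ∀ a → IsMin G a → IsMin F a → G ≤ᶜ F → Face Δ G

WeaklyClosedLabeled : SimplicialComplex n → Set
WeaklyClosedLabeled Δ =
  ∀ F → Facet Δ F → ∀ g → g ∉ F →
  ∀ a b → IsMin F a → IsMax F b → a < g → g < b →
  ∃[ G ] Face Δ G × ∣ G ∣ ≡ ∣ F ∣ × Adjacent G F × g ∈ G

SkeletonWeaklyChordalLabeled : SimplicialComplex n → Set
SkeletonWeaklyChordalLabeled Δ =
  ∀ f g → Face Δ f → Face Δ g → f ≢ g → ∣ f ∣ ≡ ∣ g ∣ →
  ∀ m → IsMax f m → IsMax g m →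
  ∃[ h ] Face Δ h × ∣ h ∣ ≡ ∣ f ∣ × h ⊆ (f ∪ g) - m

Underclosed : SimplicialComplex n → Set
Underclosed Δ = ∃[ π ] UnderclosedLabeled (relabel π Δ)

WeaklyClosed : SimplicialComplex n → Set
WeaklyClosed Δ = ∃[ π ] WeaklyClosedLabeled (relabel π Δ)

SkeletonWeaklyChordal : SimplicialComplex n → Set
SkeletonWeaklyChordal Δ = ∃[ π ] SkeletonWeaklyChordalLabeled (relabel π Δ)

{-# OPTIONS --safe #-}
-- Both implications hold with the labeling unchanged.  If Δ is underclosed, F is a
-- facet, m ∈ F, x ∉ F and min F < x < m, then F - m + x lies componentwise below
-- F and has the same minimum, so it is a face.  With m = max F this is weak
-- closedness.  Now let f ≠ g be faces of equal size with maximum m, and take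
-- x ∈ g ∖ f, y ∈ f ∖ g.  Extending f to a facet F shows that f - m + x is a face
-- unless x < min F, whence x < y; symmetrically g - m + y is a face unless y < x.
--
-- The counterexample consists of a tetrahedron and the cone, with a new apex,
-- over a 4-cycle of its edges.
module Submission where

open import Defs
open import Data.Bool.Base using (true; false)
open import Data.Bool.Properties using () renaming (_≟_ to _≟ᵇ_)
open import Data.Fin.Base using (Fin; zero; suc; _<_; _≤_)
open import Data.Fin.Patterns
import Data.Fin.Permutation as Perm
open Perm using (Permutation′; _⟨$⟩ʳ_; inverseʳ)
open import Data.Fin.Properties
  using (_≟_; _≤?_; _<?_; all?; any?; <-cmp; <⇒≢; ≤∧≢⇒<; <-asym)
open import Data.Fin.Subset
open import Data.Fin.Subset.Induction using (⊃-wellFounded; Acc; acc)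
open import Data.Fin.Subset.Properties
open import Data.List.Base using (List; []; _∷_; map; filter; allFin)
import Data.List.Base as List
open import Data.List.Properties using (map-tabulate)
open import Data.List.Membership.Propositional using () renaming (_∈_ to _∈ˡ_)
open import Data.List.Relation.Binary.Pointwise as Pointwise using (Pointwise; []; _∷_)
open import Data.List.Relation.Unary.All as All using (All)
open import Data.List.Relation.Unary.Any as Any using (Any)
open import Data.Nat.Base using (ℕ; zero; suc; z≤n; s≤s; s<s⁻¹)
import Data.Nat.Properties as ℕ
open import Data.Product.Base using (_×_; _,_; ∃-syntax; Σ-syntax; proj₁; proj₂)
open import Data.Sum.Base using (_⊎_; inj₁; inj₂)
open import Data.Vec.Base using (Vec; []; _∷_; _[_]≔_; here; there; tabulate; lookup)
import Data.Vec.Base as Vec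
open import Data.Vec.Properties
  using ([]≔-updates; []≔-minimal; lookup∘update; lookup∘update′; []=⇒lookup; lookup⇒[]=; ≡-dec)
open import Data.Vec.Relation.Unary.AllPairs using (allPairs?)
open import Data.Vec.Relation.Unary.Unique.Propositional using (Unique)
open import Data.Vec.Relation.Unary.Unique.Propositional.Properties using (tabulate⁺)
open import Function.Base using (_∘_; id)
open import Function.Bundles using (Injection)
open import Function.Properties.Inverse using (↔⇒↣)
open import Level using (0ℓ)
open import Relation.Binary.Definitions using (tri<; tri≈; tri>)
open import Relation.Binary.PropositionalEquality
open import Relation.Nullary using (Dec; yes; no; does; contradiction)
open import Relation.Nullary.Decidable
  using (map′; ¬?; _×-dec_; _→-dec_; decidable-stable; from-yes)
open import Relation.Nullary.Negation.Core using (¬_)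
open import Relation.Unary using (Pred; Decidable)

private
  variable
    n : ℕ
    F G : Subset n
    a m x y : Fin n

-- Exchanging one element of a set for another.

exchange : Subset n → Fin n → Fin n → Subset n
exchange F m x = F [ m ]≔ outside [ x ]≔ inside

∈-[]≔inside⁻ : ∀ (F : Subset n) x → y ∈ F [ x ]≔ inside → y ≡ x ⊎ y ∈ F
∈-[]≔inside⁻ {y = y} F x y∈ with y ≟ x
... | yes y≡x = inj₁ y≡x
... | no y≢x = inj₂ (lookup⇒[]= y F (trans (sym (lookup∘update′ y≢x F inside)) ([]=⇒lookup y∈)))

∈-[]≔outside⁻ : ∀ (F : Subset n) m → y ∈ F [ m ]≔ outside → y ∈ F × y ≢ m
∈-[]≔outside⁻ {y = y} F m y∈ with y ≟ m
... | yes refl = contradiction (trans (sym ([]=⇒lookup y∈)) (lookup∘update m F outside)) λ ()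
... | no y≢m =
  lookup⇒[]= y F (trans (sym (lookup∘update′ y≢m F outside)) ([]=⇒lookup y∈)) , y≢m

∈-exchange⁻ : ∀ (F : Subset n) m x → y ∈ exchange F m x → y ≡ x ⊎ (y ∈ F × y ≢ m)
∈-exchange⁻ F m x y∈ with ∈-[]≔inside⁻ (F [ m ]≔ outside) x y∈
... | inj₁ y≡x = inj₁ y≡x
... | inj₂ y∈′ = inj₂ (∈-[]≔outside⁻ F m y∈′)

x∈exchange : ∀ (F : Subset n) m x → x ∈ exchange F m x
x∈exchange F m x = []≔-updates (F [ m ]≔ outside) x

∈-exchange⁺ : y ∈ F → y ≢ m → y ≢ x → y ∈ exchange F m x
∈-exchange⁺ {y = y} {F = F} {m = m} {x = x} y∈F y≢m y≢x =
  []≔-minimal (F [ m ]≔ outside) y x y≢x ([]≔-minimal F y m y≢m y∈F)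

exchange-mono : F ⊆ G → exchange F m x ⊆ exchange G m x
exchange-mono {F = F} {G = G} {m = m} {x = x} F⊆G {y} y∈ with y ≟ x
... | yes refl = x∈exchange G m x
... | no y≢x with ∈-exchange⁻ F m x y∈
...   | inj₁ y≡x = contradiction y≡x y≢x
...   | inj₂ (y∈F , y≢m) = ∈-exchange⁺ (F⊆G y∈F) y≢m y≢x

exchange-⊆ : x ∈ F → exchange F m x ⊆ F
exchange-⊆ {x = x} {F = F} {m = m} x∈F y∈ with ∈-exchange⁻ F m x y∈
... | inj₁ refl = x∈F
... | inj₂ (y∈F , _) = y∈F

∣[]≔outside∣ : m ∈ F → suc ∣ F [ m ]≔ outside ∣ ≡ ∣ F ∣
∣[]≔outside∣ here = refl
∣[]≔outside∣ {F = outside ∷ _} (there m∈F) = ∣[]≔outside∣ m∈F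
∣[]≔outside∣ {F = inside ∷ _} (there m∈F) = cong suc (∣[]≔outside∣ m∈F)

∣[]≔inside∣ : ∀ x (F : Subset n) → x ∉ F → ∣ F [ x ]≔ inside ∣ ≡ suc ∣ F ∣
∣[]≔inside∣ zero (inside ∷ F) x∉F = contradiction here x∉F
∣[]≔inside∣ zero (outside ∷ F) x∉F = refl
∣[]≔inside∣ (suc x) (inside ∷ F) x∉F = cong suc (∣[]≔inside∣ x F (x∉F ∘ there))
∣[]≔inside∣ (suc x) (outside ∷ F) x∉F = ∣[]≔inside∣ x F (x∉F ∘ there)

∣exchange∣ : m ∈ F → x ∉ F → ∣ exchange F m x ∣ ≡ ∣ F ∣
∣exchange∣ {m = m} {F = F} {x = x} m∈F x∉F =
  trans (∣[]≔inside∣ x (F [ m ]≔ outside) (x∉F ∘ proj₁ ∘ ∈-[]≔outside⁻ F m)) (∣[]≔outside∣ m∈F)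

exchange-∩ : x ∉ F → exchange F m x ∩ F ≡ F [ m ]≔ outside
exchange-∩ {x = x} {F = F} {m = m} x∉F = ⊆-antisym to from
  where
  to : exchange F m x ∩ F ⊆ F [ m ]≔ outside
  to {y} y∈ with x∈p∩q⁻ (exchange F m x) F y∈
  ... | y∈e , y∈F with ∈-exchange⁻ F m x y∈e
  ...   | inj₁ refl = contradiction y∈F x∉F
  ...   | inj₂ (_ , y≢m) = []≔-minimal F y m y≢m y∈F
  from : F [ m ]≔ outside ⊆ exchange F m x ∩ F
  from y∈ with ∈-[]≔outside⁻ F m y∈
  ... | y∈F , y≢m = x∈p∩q⁺ (∈-exchange⁺ y∈F y≢m (λ { refl → x∉F y∈F }) , y∈F)

exchange-adjacent : m ∈ F → x ∉ F → Adjacent (exchange F m x) F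
exchange-adjacent {m = m} {F = F} {x = x} m∈F x∉F =
  size , trans (cong (suc ∘ ∣_∣) (exchange-∩ x∉F)) (trans (∣[]≔outside∣ m∈F) (sym size))
  where
  size : ∣ exchange F m x ∣ ≡ ∣ F ∣
  size = ∣exchange∣ m∈F x∉F

-- Componentwise comparison of sorted element lists.

filter-∈-map-suc : ∀ s (F : Subset n) xs →
  filter (_∈? (s ∷ F)) (map suc xs) ≡ map suc (filter (_∈? F) xs)
filter-∈-map-suc s F [] = refl
filter-∈-map-suc s F (x ∷ xs) with does (x ∈? F)
... | false = filter-∈-map-suc s F xs
... | true = cong (suc x ∷_) (filter-∈-map-suc s F xs)

-- Used to unfold `elements (s ∷ F)` along the first coordinate, so that componentwise comparisons
-- can be proved by induction on the set.
elements-there : ∀ s (F : Subset n) →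
  filter (_∈? (s ∷ F)) (List.tabulate suc) ≡ map suc (elements F)
elements-there s F =
  trans (cong (filter (_∈? (s ∷ F))) (sym (map-tabulate id suc)))
        (filter-∈-map-suc s F (allFin _))

map-suc-≤ : ∀ {xs ys : List (Fin n)} →
  Pointwise _≤_ xs ys → Pointwise _≤_ (map suc xs) (map suc ys)
map-suc-≤ = Pointwise.map⁺ suc suc ∘ Pointwise.map s≤s

zero∷-≤ : ∀ {z : Fin (suc n)} {xs ys : List (Fin (suc n))} →
  Pointwise _≤_ (z ∷ xs) ys → Pointwise _≤_ (zero ∷ xs) ys
zero∷-≤ (_ ∷ xs≤ys) = z≤n ∷ xs≤ys

-- This is the exchange that inserts `zero`, with `F` as the remaining coordinates. The new head
-- pushes every entry below `m` one place to the right, so each entry of `F` up to `m` is compared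
-- with its predecessor, and the entries after `m` with themselves.
remove-≤ : ∀ (F : Subset n) → m ∈ F →
  Pointwise _≤_ (zero ∷ map suc (elements (F [ m ]≔ outside))) (map suc (elements F))
remove-≤ (inside ∷ F) here
  rewrite elements-there outside F | elements-there inside F = z≤n ∷ Pointwise.refl ℕ.≤-refl
remove-≤ (inside ∷ F) (there {i = m} m∈F)
  rewrite elements-there inside (F [ m ]≔ outside) | elements-there inside F =
  -- The old first element moves to second place and serves as the inserted `zero` of the induction
  -- hypothesis.
  z≤n ∷ map-suc-≤ (remove-≤ F m∈F)
remove-≤ (outside ∷ F) (there {i = m} m∈F)
  rewrite elements-there outside (F [ m ]≔ outside) | elements-there outside F =
  zero∷-≤ (map-suc-≤ (remove-≤ F m∈F))

-- The two lists agree below `x`; stripping these coordinates leaves the case where `x` is `zero`,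
-- which is `remove-≤`.
exchange-≤ᶜ : ∀ (F : Subset n) → m ∈ F → x ∉ F → x < m → exchange F m x ≤ᶜ F
exchange-≤ᶜ {x = zero} (inside ∷ F) m∈F x∉F x<m = contradiction here x∉F
exchange-≤ᶜ {x = zero} (outside ∷ F) (there {i = m} m∈F) x∉F x<m
  rewrite elements-there inside (F [ m ]≔ outside) | elements-there outside F = remove-≤ F m∈F
exchange-≤ᶜ {x = suc x} (inside ∷ F) (there {i = m} m∈F) x∉F x<m
  rewrite elements-there inside (exchange F m x) | elements-there inside F =
  z≤n ∷ map-suc-≤ (exchange-≤ᶜ F m∈F (x∉F ∘ there) (s<s⁻¹ x<m))
exchange-≤ᶜ {x = suc x} (outside ∷ F) (there {i = m} m∈F) x∉F x<m
  rewrite elements-there outside (exchange F m x) | elements-there outside F =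
  map-suc-≤ (exchange-≤ᶜ F m∈F (x∉F ∘ there) (s<s⁻¹ x<m))

-- Minima, and elements separating two sets of equal size.

minimum : ∀ (F : Subset n) → x ∈ F → ∃[ a ] IsMin F a
minimum (inside ∷ F) _ = zero , here , λ _ → z≤n
minimum (outside ∷ F) (there x∈F) with minimum F x∈F
... | a , a∈F , a≤ = suc a , there a∈F , λ { (there y∈F) → s≤s (a≤ y∈F) }

⊆∧∣∣≡⇒≡ : F ⊆ G → ∣ F ∣ ≡ ∣ G ∣ → F ≡ G
⊆∧∣∣≡⇒≡ {F = F} {G = G} F⊆G eq = ⊆-antisym F⊆G G⊆F
  where
  G⊆F : G ⊆ F
  G⊆F {y} y∈G with y ∈? F
  ... | yes y∈F = y∈F
  ... | no y∉F = contradiction eq (ℕ.<⇒≢ (p⊂q⇒∣p∣<∣q∣ (F⊆G , y , y∈G , y∉F)))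

∃∈∖ : ∀ (F G : Subset n) → F ≢ G → ∣ F ∣ ≡ ∣ G ∣ → ∃[ x ] x ∈ F × x ∉ G
∃∈∖ F G F≢G eq with any? (λ x → (x ∈? F) ×-dec ¬? (x ∈? G))
... | yes p = p
... | no ∄ = contradiction
  (⊆∧∣∣≡⇒≡ (λ {x} x∈F → decidable-stable (x ∈? G) (λ x∉G → ∄ (x , x∈F , x∉G))) eq) F≢G

-- From underclosed to weakly-closed and skeleton-weakly-chordal.

module _ (Δ : SimplicialComplex n) where
  open SimplicialComplex Δ using (face?; down-closed)

  -- Vertices are added one at a time; this stops because strict inclusion of subsets of a finite
  -- set is well-founded upwards.
  extend-to-facet : Face Δ F → ∃[ G ] Facet Δ G × F ⊆ G
  extend-to-facet {F} = go F (⊃-wellFounded F)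
    where
    go : ∀ F → Acc _⊃_ F → Face Δ F → ∃[ G ] Facet Δ G × F ⊆ G
    go F (acc larger) face with any? (λ v → ¬? (v ∈? F) ×-dec face? (F ∪ ⁅ v ⁆))
    ... | yes (v , v∉F , face′)
      with go (F ∪ ⁅ v ⁆) (larger (p⊆p∪q ⁅ v ⁆ , v , x∈p∪q⁺ (inj₂ (x∈⁅x⁆ v)) , v∉F)) face′
    ...   | G , facet , F∪v⊆G = G , facet , F∪v⊆G ∘ p⊆p∪q ⁅ v ⁆
    -- A larger face would, by downward closure, already allow one of its vertices to be added to
    -- `F`.
    go F _ face | no maximal = F , (face , λ G faceG F⊆G → ⊆-antisym F⊆G (G⊆F faceG F⊆G)) , id
      where
      G⊆F : Face Δ G → F ⊆ G → G ⊆ F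
      G⊆F {G} faceG F⊆G {v} v∈G = decidable-stable (v ∈? F) λ v∉F →
        maximal (v , v∉F , down-closed F∪v⊆G faceG)
        where
        F∪v⊆G : F ∪ ⁅ v ⁆ ⊆ G
        F∪v⊆G y∈ with x∈p∪q⁻ F ⁅ v ⁆ y∈
        ... | inj₁ y∈F = F⊆G y∈F
        ... | inj₂ y∈v rewrite x∈⁅y⁆⇒x≡y v y∈v = v∈G

  module _ (underclosed : UnderclosedLabeled Δ) where

    -- Since `a < x < m`, the minimum `a` is neither removed nor undercut, so the underclosed
    -- condition applies.
    facet-exchange : Facet Δ F → IsMin F a → m ∈ F → x ∉ F → a < x → x < m →
                     Face Δ (exchange F m x)
    facet-exchange {F} {a} {m} {x} facet (a∈F , a≤) m∈F x∉F a<x x<m =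
      underclosed F facet (exchange F m x) (∣exchange∣ m∈F x∉F) a
        (∈-exchange⁺ a∈F (<⇒≢ (ℕ.<-trans a<x x<m)) (<⇒≢ a<x) , a≤′) (a∈F , a≤)
        (exchange-≤ᶜ F m∈F x∉F x<m)
      where
      a≤′ : y ∈ exchange F m x → a ≤ y
      a≤′ y∈ with ∈-exchange⁻ F m x y∈
      ... | inj₁ refl = ℕ.<⇒≤ a<x
      ... | inj₂ (y∈F , _) = a≤ y∈F

    underclosed⇒weaklyClosed : WeaklyClosedLabeled Δ
    underclosed⇒weaklyClosed F facet g g∉F a b minF (b∈F , _) a<g g<b =
      exchange F b g , facet-exchange facet minF b∈F g∉F a<g g<b ,
      ∣exchange∣ b∈F g∉F , exchange-adjacent b∈F g∉F , x∈exchange F b g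

    -- The exchange is made in a facet `G` containing `F`. If `x` is already in `G`, the result lies
    -- inside `G`; the only obstruction is `x` below the minimum of `G`, hence below all of `F`.
    face-exchange : Face Δ F → m ∈ F → x ∉ F → x < m →
                    Face Δ (exchange F m x) ⊎ (∀ {y} → y ∈ F → x < y)
    face-exchange {F} {m} {x} face m∈F x∉F x<m
      with extend-to-facet face
    ... | G , facet@(faceG , _) , F⊆G with x ∈? G | minimum G (F⊆G m∈F)
    ...   | yes x∈G | _ = inj₁ (down-closed (exchange-⊆ x∈G ∘ exchange-mono F⊆G) faceG)
    ...   | no x∉G | a , minG@(a∈G , a≤) with <-cmp a x
    ...     | tri< a<x _ _ = inj₁ (down-closed (exchange-mono F⊆G)
                (facet-exchange facet minG (F⊆G m∈F) x∉G a<x x<m))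
    ...     | tri≈ _ refl _ = contradiction a∈G x∉G
    ...     | tri> _ _ x<a = inj₂ λ y∈F → ℕ.<-≤-trans x<a (a≤ (F⊆G y∈F))

    underclosed⇒skeletonWeaklyChordal : SkeletonWeaklyChordalLabeled Δ
    underclosed⇒skeletonWeaklyChordal f g face-f face-g f≢g ∣f∣≡∣g∣ m (m∈f , f≤m) (m∈g , g≤m)
      with ∃∈∖ g f (f≢g ∘ sym) (sym ∣f∣≡∣g∣) | ∃∈∖ f g f≢g ∣f∣≡∣g∣
    ... | x , x∈g , x∉f | y , y∈f , y∉g
      with face-exchange face-f m∈f x∉f (≤∧≢⇒< (g≤m x∈g) λ { refl → x∉f m∈f })
         | face-exchange face-g m∈g y∉g (≤∧≢⇒< (f≤m y∈f) λ { refl → y∉g m∈g })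
    ... | inj₂ x<f | inj₂ y<g = contradiction (y<g x∈g) (<-asym (x<f y∈f))
    ... | inj₁ face | _ = exchange f m x , face , ∣exchange∣ m∈f x∉f , h⊆
      where
      h⊆ : exchange f m x ⊆ (f ∪ g) - m
      h⊆ z∈ with ∈-exchange⁻ f m x z∈
      ... | inj₁ refl = x∈p∧x≢y⇒x∈p-y (q⊆p∪q f g x∈g) λ { refl → x∉f m∈f }
      ... | inj₂ (z∈f , z≢m) = x∈p∧x≢y⇒x∈p-y (p⊆p∪q g z∈f) z≢m
    ... | inj₂ _ | inj₁ face =
      exchange g m y , face , trans (∣exchange∣ m∈g y∉g) (sym ∣f∣≡∣g∣) , h⊆
      where
      h⊆ : exchange g m y ⊆ (f ∪ g) - m
      h⊆ z∈ with ∈-exchange⁻ g m y z∈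
      ... | inj₁ refl = x∈p∧x≢y⇒x∈p-y (p⊆p∪q g y∈f) λ { refl → y∉g m∈g }
      ... | inj₂ (z∈g , z≢m) = x∈p∧x≢y⇒x∈p-y (q⊆p∪q f g z∈g) z≢m

-- Facets under relabeling.

preimage-⊆⁻ : ∀ (π : Permutation′ n) → preimage π F ⊆ preimage π G → F ⊆ G
preimage-⊆⁻ {F = F} {G = G} π F⊆G {x} x∈F =
  subst (_∈ G) (inverseʳ π)
    (∈-preimage⁻ π (F⊆G (∈-preimage⁺ π (subst (_∈ F) (sym (inverseʳ π)) x∈F))))

relabel-facet : ∀ (π : Permutation′ n) (Δ : SimplicialComplex n) →
                Facet Δ (preimage π F) → Facet (relabel π Δ) F
relabel-facet {F = F} π Δ (face , maximal) = face , λ G faceG F⊆G →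
  ⊆-antisym F⊆G (preimage-⊆⁻ π (⊆-reflexive (sym
    (maximal (preimage π G) faceG (∈-preimage⁺ π ∘ F⊆G ∘ ∈-preimage⁻ π)))))

-- Decision procedures for the labeled properties.

allSubset? : ∀ {P : Pred (Subset n) 0ℓ} → Decidable P → Dec (∀ F → P F)
allSubset? P? = map′ (λ ∄ F → decidable-stable (P? F) (λ ¬P → ∄ (F , ¬P)))
                     (λ { ∀P (F , ¬P) → ¬P (∀P F) })
                     (¬? (anySubset? (¬? ∘ P?)))

allVec? : ∀ {k} {P : Pred (Vec (Fin n) k) 0ℓ} → Decidable P → Dec (∀ v → P v)
allVec? {k = zero} P? = map′ (λ { p [] → p }) (λ p → p []) (P? [])
allVec? {k = suc k} P? = map′ (λ { p (x ∷ v) → p x v }) (λ p x v → p (x ∷ v))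
                              (all? λ x → allVec? λ v → P? (x ∷ v))

_≟ˢ_ : ∀ (F G : Subset n) → Dec (F ≡ G)
_≟ˢ_ = ≡-dec _≟ᵇ_

isMin? : ∀ (F : Subset n) → Decidable (IsMin F)
isMin? F m = (m ∈? F) ×-dec
  map′ (λ m≤ {x} → m≤ x) (λ m≤ x → m≤ {x}) (all? λ x → (x ∈? F) →-dec (m ≤? x))

isMax? : ∀ (F : Subset n) → Decidable (IsMax F)
isMax? F m = (m ∈? F) ×-dec
  map′ (λ ≤m {x} → ≤m x) (λ ≤m x → ≤m {x}) (all? λ x → (x ∈? F) →-dec (x ≤? m))

module _ (Δ : SimplicialComplex n) where
  open SimplicialComplex Δ using (face?)

  facet? : Decidable (Facet Δ)
  facet? F = face? F ×-dec allSubset? λ G → face? G →-dec (F ⊆? G →-dec F ≟ˢ G)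

  weaklyClosedLabeled? : Dec (WeaklyClosedLabeled Δ)
  weaklyClosedLabeled? =
    allSubset? λ F → facet? F →-dec all? λ g → ¬? (g ∈? F) →-dec
    all? λ a → all? λ b → isMin? F a →-dec (isMax? F b →-dec (a <? g →-dec (g <? b →-dec
    anySubset? λ G → face? G ×-dec ∣ G ∣ ℕ.≟ ∣ F ∣ ×-dec
      ((∣ G ∣ ℕ.≟ ∣ F ∣) ×-dec (suc ∣ G ∩ F ∣ ℕ.≟ ∣ G ∣)) ×-dec g ∈? G)))

  skeletonWeaklyChordalLabeled? : Dec (SkeletonWeaklyChordalLabeled Δ)
  skeletonWeaklyChordalLabeled? =
    allSubset? λ f → allSubset? λ g → face? f →-dec (face? g →-dec (¬? (f ≟ˢ g) →-dec
    (∣ f ∣ ℕ.≟ ∣ g ∣ →-dec all? λ m → isMax? f m →-dec (isMax? g m →-dec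
    anySubset? λ h → face? h ×-dec ∣ h ∣ ℕ.≟ ∣ f ∣ ×-dec h ⊆? ((f ∪ g) - m)))))

-- The counterexample.

⟪_⟫ : List (Fin n) → Subset n
⟪ xs ⟫ = ⋃ (map ⁅_⁆ xs)

-- The apex is `4F` and the 4-cycle runs through `0F`, `1F`, `2F`, `3F` in this order; the edges
-- `0F 2F` and `1F 3F` of the tetrahedron are not coned.
facets : List (Subset 5)
facets = ⟪ 0F ∷ 1F ∷ 4F ∷ [] ⟫
       ∷ ⟪ 1F ∷ 2F ∷ 4F ∷ [] ⟫
       ∷ ⟪ 2F ∷ 3F ∷ 4F ∷ [] ⟫
       ∷ ⟪ 0F ∷ 3F ∷ 4F ∷ [] ⟫
       ∷ ⟪ 0F ∷ 1F ∷ 2F ∷ 3F ∷ [] ⟫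
       ∷ []

coned-tetrahedron : SimplicialComplex 5
coned-tetrahedron = record
  { Face        = λ F → Any (F ⊆_) facets
  ; face?       = covered?
  ; down-closed = λ G⊆F → Any.map (⊆-trans G⊆F)
  ; vertex      = from-yes (all? λ v → covered? ⁅ v ⁆)
  }
  where
  covered? : Decidable (λ F → Any (F ⊆_) facets)
  covered? F = Any.any? (F ⊆?_) facets

-- Lets the search over labelings test for facets by membership in the list instead of by
-- maximality.
facets-facet : All (Facet coned-tetrahedron) facets
facets-facet = from-yes (All.all? (facet? coned-tetrahedron) facets)

coned-tetrahedron-weaklyClosed : WeaklyClosed coned-tetrahedron
coned-tetrahedron-weaklyClosed =
  Perm.id , from-yes (weaklyClosedLabeled? (relabel Perm.id coned-tetrahedron))

coned-tetrahedron-skeletonWeaklyChordal : SkeletonWeaklyChordal coned-tetrahedron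
coned-tetrahedron-skeletonWeaklyChordal =
  Perm.id , from-yes (skeletonWeaklyChordalLabeled? (relabel Perm.id coned-tetrahedron))

Below : Subset n × Subset n → Set
Below (F , G) = ∣ G ∣ ≡ ∣ F ∣ × (∃[ a ] IsMin G a × IsMin F a) × G ≤ᶜ F

below? : Decidable (Below {n})
below? (F , G) = ∣ G ∣ ℕ.≟ ∣ F ∣ ×-dec (any? λ a → isMin? G a ×-dec isMin? F a) ×-dec
                 Pointwise.decidable _≤?_ (elements G) (elements F)

-- In every labeling, one of these pairs (F , G) has F a facet and G not a face.
-- The first four serve the labelings giving the apex label 0 or 4; if the label is
-- 1, 2 or 3, then one of the last three has the tetrahedron as F, and its G is not
-- a face since it has size 4 and contains the apex.
moves : List (Subset 5 × Subset 5)
moves = (⟪ 0F ∷ 3F ∷ 4F ∷ [] ⟫ , ⟪ 0F ∷ 1F ∷ 4F ∷ [] ⟫)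
      ∷ (⟪ 0F ∷ 3F ∷ 4F ∷ [] ⟫ , ⟪ 0F ∷ 2F ∷ 4F ∷ [] ⟫)
      ∷ (⟪ 1F ∷ 3F ∷ 4F ∷ [] ⟫ , ⟪ 1F ∷ 2F ∷ 4F ∷ [] ⟫)
      ∷ (⟪ 0F ∷ 2F ∷ 4F ∷ [] ⟫ , ⟪ 0F ∷ 1F ∷ 2F ∷ [] ⟫)
      ∷ (⟪ 0F ∷ 1F ∷ 2F ∷ 4F ∷ [] ⟫ , ⟪ 0F ∷ 1F ∷ 2F ∷ 3F ∷ [] ⟫)
      ∷ (⟪ 0F ∷ 1F ∷ 3F ∷ 4F ∷ [] ⟫ , ⟪ 0F ∷ 1F ∷ 2F ∷ 3F ∷ [] ⟫)
      ∷ (⟪ 0F ∷ 2F ∷ 3F ∷ 4F ∷ [] ⟫ , ⟪ 0F ∷ 1F ∷ 2F ∷ 3F ∷ [] ⟫)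
      ∷ []

moves-below : All Below moves
moves-below = from-yes (All.all? below? moves)

-- preimage π for the permutation π with list of values p.
pullback : Vec (Fin 5) 5 → Subset 5 → Subset 5
pullback p S = Vec.map (lookup S) p

Violated : Vec (Fin 5) 5 → Subset 5 × Subset 5 → Set
Violated p (F , G) = pullback p F ∈ˡ facets × ¬ Face coned-tetrahedron (pullback p G)

-- Exhaustive search over value vectors without repetition. By hand, for apex label 4: if 03 is a
-- cycle edge, 01 or 02 is not, and one of the first two moves is violated; otherwise 13 is an edge
-- and 12 is not, and the third is. For apex label 0: if 34 is an edge, 14 or 24 is not, and the
-- first or second move is violated; otherwise 24 is an edge and 12 is not, and the fourth is.
some-move-violated : ∀ p → Unique p → Any (Violated p) moves
some-move-violated = from-yes (allVec? λ p → allPairs? (λ x y → ¬? (x ≟ y)) p →-dec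
  Any.any? (λ { (F , G) → Any.any? (pullback p F ≟ˢ_) facets ×-dec
    ¬? (SimplicialComplex.face? coned-tetrahedron (pullback p G)) }) moves)

coned-tetrahedron-not-underclosed : ¬ Underclosed coned-tetrahedron
coned-tetrahedron-not-underclosed (π , underclosed) =
  All.lookupWith refute moves-below
    (some-move-violated (tabulate (π ⟨$⟩ʳ_)) (tabulate⁺ (Injection.injective (↔⇒↣ π))))
  where
  refute : ∀ {move} → Below move → ¬ Violated (tabulate (π ⟨$⟩ʳ_)) move
  refute {F , G} (size , (a , minG , minF) , G≤F) (F∈ , ¬face) =
    ¬face (underclosed F (relabel-facet π coned-tetrahedron (All.lookup facets-facet F∈))
                       G size a minG minF G≤F)

corollary41 : (∀ (n : ℕ) (Δ : SimplicialComplex n) →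
    Underclosed Δ → WeaklyClosed Δ × SkeletonWeaklyChordal Δ)
    ×
    (Σ[ n ∈ ℕ ] Σ[ Δ ∈ SimplicialComplex n ]
    (WeaklyClosed Δ × SkeletonWeaklyChordal Δ × ¬ Underclosed Δ))
corollary41 =
  (λ n Δ (π , underclosed) →
    (π , underclosed⇒weaklyClosed (relabel π Δ) underclosed) ,
    (π , underclosed⇒skeletonWeaklyChordal (relabel π Δ) underclosed)) ,
  (5 , coned-tetrahedron , coned-tetrahedron-weaklyClosed ,
    coned-tetrahedron-skeletonWeaklyChordal , coned-tetrahedron-not-underclosed)
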